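{- Let $\mathcal{F}$ be the folded component (with vertex set $\{0,1,\dots,\mathrm{ord}(\ell)-1\}$ and edges as specified in the context). Let $v\in V(\mathcal{F})\setminus\{0\}$ be such that $2\mid v$. Then $$\mathrm{ecc}(v)=\begin{cases}\frac12 v+1 & \text{if } v\ge\frac12(\mathrm{ord}(\ell)+1),\\ \frac12(\mathrm{ord}(\ell)-v+3) & \text{if } v<\frac12(\mathrm{ord}(\ell)+1).\end{cases}$$
   Context: Let $p$ be a prime with $p\equiv 71$ or $119\pmod{120}$, let $\ell=2$, and let $\mathrm{ord}(\ell)$ be the order, in the ideal class group of $\mathbb{Q}(\sqrt{ -p})$, of a prime ideal above $2$; it is an odd integer $\ge 3$. The folded component $\mathcal{F}$ (a component of the supersingular $2$-isogeny graph over $\mathbb{F}_p$ after identifying curves up to $\overline{\mathbb{F}_p}$-isomorphism, regarded as a simple undirected graph) is labelled so that $V(\mathcal{F})=\{0,1,\dots,\mathrm{ord}(\ell)-1\}$ and $$E(\mathcal{F})=\{\{2k-1,2k+1\}: 1\le k\le \tfrac12(\mathrm{ord}(\ell)-3)\}\cup\{\{2k+1,2k+2\}:0\le k\le \tfrac12(\mathrm{ord}(\ell)-3)\}\cup\{\{0,1\}\}.$$ The eccentricity $\mathrm{ecc}(v)$ is the maximum graph distance from $v$ to any vertex of $\mathcal{F}$. -}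

module Defs where

open import Algebra.Bundles using (CommutativeRing)
open import Algebra.Structures using (IsCommutativeRing)
open import Data.Fin.Base using (Fin; toℕ)
open import Data.Integer.Base as ℤ using (ℤ; +_; 0ℤ; 1ℤ)
open import Data.Integer.Tactic.RingSolver using (solve-∀)
open import Data.Nat.Base as ℕ using (ℕ; zero; suc; _≤_; _<_; _∸_; _/_)
import Data.Nat.Properties as ℕₚ
open import Data.Product.Base using (∃-syntax; _×_; _,_)
open import Data.Sum.Base using (_⊎_)
open import Data.Unit.Polymorphic.Base using (⊤; tt)
open import Level using (0ℓ; _⊔_) renaming (suc to lsuc)
open import Relation.Binary.Construct.Closure.Symmetric using (SymClosure; fwd; bwd; symmetric)
open import Relation.Binary.Core using (Rel)
open import Relation.Binary.PropositionalEquality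
  using (_≡_; refl; trans; cong₂; isEquivalence)
open import Relation.Nullary.Negation.Core using (¬_)

module _ {c ℓ} (R : CommutativeRing c ℓ) where
  open CommutativeRing R
    using (Carrier; _≈_; _+_; _*_; 0#; 1#; +-cong; +-assoc; +-identityˡ; zeroʳ; distribˡ; *-congˡ)
    renaming (refl to ≈-refl; sym to ≈-sym; trans to ≈-trans)

  record Ideal : Set (lsuc (c ⊔ ℓ)) where
    field
      mem    : Carrier → Set (c ⊔ ℓ)
      resp   : ∀ {x y} → x ≈ y → mem x → mem y
      0∈     : mem 0#
      +-clos : ∀ {x y} → mem x → mem y → mem (x + y)
      *-clos : ∀ r {x} → mem x → mem (r * x)

  open Ideal

  infix 4 _∈ᴵ_ _∼_
  infixl 7 _·_
  infixr 8 _^ᴵ_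

  _∈ᴵ_ : Carrier → Ideal → Set (c ⊔ ℓ)
  x ∈ᴵ I = mem I x

  unitIdeal : Ideal
  unitIdeal = record
    { mem = λ _ → ⊤ ; resp = λ _ _ → tt ; 0∈ = tt ; +-clos = λ _ _ → tt ; *-clos = λ _ _ → tt }

  -- finite sums of products x * y with x ∈ I and y ∈ J
  data ProductMem (I J : Ideal) : Carrier → Set (c ⊔ ℓ) where
    empty : ∀ {z} → z ≈ 0# → ProductMem I J z
    add   : ∀ {z} x y w → x ∈ᴵ I → y ∈ᴵ J → ProductMem I J w →
            z ≈ (x * y) + w → ProductMem I J z

  _·_ : Ideal → Ideal → Ideal
  I · J = record
    { mem = ProductMem I J ; resp = resp′ ; 0∈ = empty ≈-refl ; +-clos = plus ; *-clos = times }
    where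
    resp′ : ∀ {x y} → x ≈ y → ProductMem I J x → ProductMem I J y
    resp′ e (empty z≈0)           = empty (≈-trans (≈-sym e) z≈0)
    resp′ e (add x y w p q s z≈) = add x y w p q s (≈-trans (≈-sym e) z≈)

    plus : ∀ {a b} → ProductMem I J a → ProductMem I J b → ProductMem I J (a + b)
    plus (empty a≈0) t =
      resp′ (≈-sym (≈-trans (+-cong a≈0 ≈-refl) (+-identityˡ _))) t
    plus (add x y w p q s a≈) t =
      add x y _ p q (plus s t) (≈-trans (+-cong a≈ ≈-refl) (+-assoc _ _ _))

    times : ∀ r {a} → ProductMem I J a → ProductMem I J (r * a)
    times r (empty a≈0) = empty (≈-trans (*-congˡ a≈0) (zeroʳ r))
    times r (add x y w p q s a≈) =
      add (r * x) y (r * w) (*-clos I r p) q (times r s)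
        (≈-trans (*-congˡ a≈) (≈-trans (distribˡ r _ _)
          (+-cong (≈-sym (CommutativeRing.*-assoc R r x y)) ≈-refl)))

  _^ᴵ_ : Ideal → ℕ → Ideal
  I ^ᴵ zero  = unitIdeal
  I ^ᴵ suc n = I · (I ^ᴵ n)

  record IsPrime (I : Ideal) : Set (c ⊔ ℓ) where
    field
      proper : ¬ (1# ∈ᴵ I)
      prime  : ∀ x y → (x * y) ∈ᴵ I → x ∈ᴵ I ⊎ y ∈ᴵ I

  -- x ∈ α I
  MultipleMem : Carrier → Ideal → Carrier → Set (c ⊔ ℓ)
  MultipleMem α I x = ∃[ y ] (y ∈ᴵ I × x ≈ α * y)

  -- Equality of ideal classes (for nonzero ideals of a domain):
  -- α I = β J for some nonzero α and β.
  _∼_ : Ideal → Ideal → Set (c ⊔ ℓ)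
  I ∼ J = ∃[ α ] ∃[ β ] (¬ (α ≈ 0#) × ¬ (β ≈ 0#) ×
    (∀ x → (MultipleMem α I x → MultipleMem β J x) × (MultipleMem β J x → MultipleMem α I x)))

  record IsClassOrder (I : Ideal) (n : ℕ) : Set (c ⊔ ℓ) where
    field
      positive : 1 ≤ n
      trivial  : (I ^ᴵ n) ∼ unitIdeal
      minimal  : ∀ m → 1 ≤ m → (I ^ᴵ m) ∼ unitIdeal → n ≤ m

infix 5 _+ω_

-- a +ω b stands for a + b ω
record Quad : Set where
  constructor _+ω_
  field
    re : ℤ
    im : ℤ

-- ℤ[ω] with ω² = ω - m
module _ (m : ℤ) where
  private
    _⊕_ _⊗_ : Quad → Quad → Quad
    (a +ω b) ⊕ (c +ω d) = (a ℤ.+ c) +ω (b ℤ.+ d)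
    (a +ω b) ⊗ (c +ω d) =
      (a ℤ.* c ℤ.- m ℤ.* (b ℤ.* d)) +ω (a ℤ.* d ℤ.+ b ℤ.* c ℤ.+ b ℤ.* d)

    ⊖_ : Quad → Quad
    ⊖ (a +ω b) = (ℤ.- a) +ω (ℤ.- b)

    𝟘 𝟙 : Quad
    𝟘 = 0ℤ +ω 0ℤ
    𝟙 = 1ℤ +ω 0ℤ

    ext : ∀ {a b c d} → a ≡ c → b ≡ d → (a +ω b) ≡ (c +ω d)
    ext = cong₂ _+ω_

    +-assoc-re : ∀ a b c → (a ℤ.+ b) ℤ.+ c ≡ a ℤ.+ (b ℤ.+ c)
    +-assoc-re = solve-∀
    +-comm-re : ∀ a b → a ℤ.+ b ≡ b ℤ.+ a
    +-comm-re = solve-∀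
    +-idˡ-re : ∀ a → 0ℤ ℤ.+ a ≡ a
    +-idˡ-re = solve-∀
    +-idʳ-re : ∀ a → a ℤ.+ 0ℤ ≡ a
    +-idʳ-re = solve-∀
    +-invˡ-re : ∀ a → (ℤ.- a) ℤ.+ a ≡ 0ℤ
    +-invˡ-re = solve-∀
    +-invʳ-re : ∀ a → a ℤ.+ (ℤ.- a) ≡ 0ℤ
    +-invʳ-re = solve-∀

    *-assoc-re : ∀ m a b c d e f →
      (a ℤ.* c ℤ.- m ℤ.* (b ℤ.* d)) ℤ.* e ℤ.- m ℤ.* ((a ℤ.* d ℤ.+ b ℤ.* c ℤ.+ b ℤ.* d) ℤ.* f)
      ≡ a ℤ.* (c ℤ.* e ℤ.- m ℤ.* (d ℤ.* f)) ℤ.- m ℤ.* (b ℤ.* (c ℤ.* f ℤ.+ d ℤ.* e ℤ.+ d ℤ.* f))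
    *-assoc-re = solve-∀
    *-assoc-im : ∀ m a b c d e f →
      (a ℤ.* c ℤ.- m ℤ.* (b ℤ.* d)) ℤ.* f ℤ.+ (a ℤ.* d ℤ.+ b ℤ.* c ℤ.+ b ℤ.* d) ℤ.* e
        ℤ.+ (a ℤ.* d ℤ.+ b ℤ.* c ℤ.+ b ℤ.* d) ℤ.* f
      ≡ a ℤ.* (c ℤ.* f ℤ.+ d ℤ.* e ℤ.+ d ℤ.* f) ℤ.+ b ℤ.* (c ℤ.* e ℤ.- m ℤ.* (d ℤ.* f))
        ℤ.+ b ℤ.* (c ℤ.* f ℤ.+ d ℤ.* e ℤ.+ d ℤ.* f)
    *-assoc-im = solve-∀
    *-comm-re : ∀ m a b c d →
      a ℤ.* c ℤ.- m ℤ.* (b ℤ.* d) ≡ c ℤ.* a ℤ.- m ℤ.* (d ℤ.* b)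
    *-comm-re = solve-∀
    *-comm-im : ∀ a b c d →
      a ℤ.* d ℤ.+ b ℤ.* c ℤ.+ b ℤ.* d ≡ c ℤ.* b ℤ.+ d ℤ.* a ℤ.+ d ℤ.* b
    *-comm-im = solve-∀
    *-idˡ-re : ∀ m a b → 1ℤ ℤ.* a ℤ.- m ℤ.* (0ℤ ℤ.* b) ≡ a
    *-idˡ-re = solve-∀
    *-idˡ-im : ∀ a b → 1ℤ ℤ.* b ℤ.+ 0ℤ ℤ.* a ℤ.+ 0ℤ ℤ.* b ≡ b
    *-idˡ-im = solve-∀
    distribˡ-re : ∀ m a b c d e f →
      a ℤ.* (c ℤ.+ e) ℤ.- m ℤ.* (b ℤ.* (d ℤ.+ f))
      ≡ (a ℤ.* c ℤ.- m ℤ.* (b ℤ.* d)) ℤ.+ (a ℤ.* e ℤ.- m ℤ.* (b ℤ.* f))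
    distribˡ-re = solve-∀
    distribˡ-im : ∀ a b c d e f →
      a ℤ.* (d ℤ.+ f) ℤ.+ b ℤ.* (c ℤ.+ e) ℤ.+ b ℤ.* (d ℤ.+ f)
      ≡ (a ℤ.* d ℤ.+ b ℤ.* c ℤ.+ b ℤ.* d) ℤ.+ (a ℤ.* f ℤ.+ b ℤ.* e ℤ.+ b ℤ.* f)
    distribˡ-im = solve-∀

    ⊗-comm : ∀ x y → x ⊗ y ≡ y ⊗ x
    ⊗-comm (a +ω b) (c +ω d) = ext (*-comm-re m a b c d) (*-comm-im a b c d)

    ⊗-idˡ : ∀ x → 𝟙 ⊗ x ≡ x
    ⊗-idˡ (a +ω b) = ext (*-idˡ-re m a b) (*-idˡ-im a b)

    ⊗-distribˡ : ∀ x y z → x ⊗ (y ⊕ z) ≡ (x ⊗ y) ⊕ (x ⊗ z)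
    ⊗-distribˡ (a +ω b) (c +ω d) (e +ω f) =
      ext (distribˡ-re m a b c d e f) (distribˡ-im a b c d e f)

    isCommutativeRing : IsCommutativeRing _≡_ _⊕_ _⊗_ ⊖_ 𝟘 𝟙
    isCommutativeRing = record
      { isRing = record
        { +-isAbelianGroup = record
          { isGroup = record
            { isMonoid = record
              { isSemigroup = record
                { isMagma = record { isEquivalence = isEquivalence ; ∙-cong = cong₂ _⊕_ }
                ; assoc = λ { (a +ω b) (c +ω d) (e +ω f) → ext (+-assoc-re a c e) (+-assoc-re b d f) } }
              ; identity = (λ { (a +ω b) → ext (+-idˡ-re a) (+-idˡ-re b) })
                         , (λ { (a +ω b) → ext (+-idʳ-re a) (+-idʳ-re b) }) }
            ; inverse = (λ { (a +ω b) → ext (+-invˡ-re a) (+-invˡ-re b) })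
                      , (λ { (a +ω b) → ext (+-invʳ-re a) (+-invʳ-re b) })
            ; ⁻¹-cong = λ { refl → refl } }
          ; comm = λ { (a +ω b) (c +ω d) → ext (+-comm-re a c) (+-comm-re b d) } }
        ; *-cong = cong₂ _⊗_
        ; *-assoc = λ { (a +ω b) (c +ω d) (e +ω f) →
            ext (*-assoc-re m a b c d e f) (*-assoc-im m a b c d e f) }
        ; *-identity = ⊗-idˡ , (λ x → trans (⊗-comm x 𝟙) (⊗-idˡ x))
        ; distrib = ⊗-distribˡ
                  , (λ x y z → trans (⊗-comm (y ⊕ z) x)
                      (trans (⊗-distribˡ x y z) (cong₂ _⊕_ (⊗-comm x y) (⊗-comm x z)))) }
      ; *-comm = ⊗-comm }

  quadraticRing : CommutativeRing 0ℓ 0ℓ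
  quadraticRing = record { isCommutativeRing = isCommutativeRing }

-- The ring of integers of ℚ(√-p) for p squarefree with p ≡ 3 (mod 4): it is ℤ[ω]
-- with ω = (1 + √-p) / 2, so that ω² = ω - (p + 1) / 4.
𝓞 : ℕ → CommutativeRing 0ℓ 0ℓ
𝓞 p = quadraticRing (+ ((p ℕ.+ 1) / 4))

record IsPrimeAbove2 (p : ℕ) (𝔩 : Ideal (𝓞 p)) : Set where
  field
    isPrime : IsPrime (𝓞 p) 𝔩
    above   : Ideal.mem 𝔩 (+ 2 +ω 0ℤ)

record SimpleGraph : Set₁ where
  field
    Vertex : Set
    Adj    : Rel Vertex 0ℓ
    adj-sym    : ∀ {u v} → Adj u v → Adj v u
    adj-irrefl : ∀ {v} → ¬ Adj v v

module _ (G : SimpleGraph) where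
  open SimpleGraph G

  data Walk : Vertex → Vertex → ℕ → Set where
    []  : ∀ {v} → Walk v v 0
    _∷_ : ∀ {u v w d} → Adj u v → Walk v w d → Walk u w (suc d)

  IsDistance : Vertex → Vertex → ℕ → Set
  IsDistance u v d = Walk u v d × (∀ e → Walk u v e → d ≤ e)

  -- e is the maximum of the distances from v; in particular all of them are finite.
  record IsEccentricity (v : Vertex) (e : ℕ) : Set where
    field
      attained : ∃[ w ] IsDistance v w e
      bounded  : ∀ w → ∃[ d ] (IsDistance v w d × d ≤ e)

  IsEccentricity-unique : ∀ {v e e′} → IsEccentricity v e → IsEccentricity v e′ → e ≡ e′
  IsEccentricity-unique E E′ = ℕₚ.≤-antisym (le E E′) (le E′ E)
    where
    le : ∀ {v e e′} → IsEccentricity v e → IsEccentricity v e′ → e ≤ e′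
    le E E′ with IsEccentricity.attained E
    ... | w , _ , least with IsEccentricity.bounded E′ w
    ...   | d , (walk , _) , d≤e′ = ℕₚ.≤-trans (least d walk) d≤e′

-- Endpoints of the edges; the parameter n, the number of vertices, is meant to be odd
-- and at least 3, which makes (n ∸ 3) / 2 exact.
data FoldedEdge (n : ℕ) (u v : Fin n) : Set where
  path : ∀ k → 1 ≤ k → k ≤ (n ∸ 3) / 2 →
         toℕ u ≡ 2 ℕ.* k ∸ 1 → toℕ v ≡ 2 ℕ.* k ℕ.+ 1 → FoldedEdge n u v
  leaf : ∀ k → k ≤ (n ∸ 3) / 2 →
         toℕ u ≡ 2 ℕ.* k ℕ.+ 1 → toℕ v ≡ 2 ℕ.* k ℕ.+ 2 → FoldedEdge n u v
  root : toℕ u ≡ 0 → toℕ v ≡ 1 → FoldedEdge n u v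

private
  edge-< : ∀ {n} {u v : Fin n} → FoldedEdge n u v → toℕ u < toℕ v
  edge-< (path k _ _ p q) rewrite p | q =
    ℕₚ.≤-<-trans (ℕₚ.m∸n≤m (2 ℕ.* k) 1) (ℕₚ.m<m+n (2 ℕ.* k) (ℕ.s≤s ℕ.z≤n))
  edge-< (leaf k _ p q) rewrite p | q = ℕₚ.+-monoʳ-< (2 ℕ.* k) (ℕ.s≤s (ℕ.s≤s ℕ.z≤n))
  edge-< (root p q) rewrite p | q = ℕ.s≤s ℕ.z≤n

foldedComponent : ℕ → SimpleGraph
foldedComponent n = record
  { Vertex     = Fin n
  ; Adj        = SymClosure (FoldedEdge n)
  ; adj-sym    = symmetric (FoldedEdge n)
  ; adj-irrefl = λ { (fwd e) → ℕₚ.<-irrefl refl (edge-< e)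
                   ; (bwd e) → ℕₚ.<-irrefl refl (edge-< e) }
  }

{-# OPTIONS --safe #-}
-- For n = 2N + 3 the graph is a caterpillar: the spine 1, 3, …, 2N + 1, with the leaf
-- 2k + 2 attached to 2k + 1 and the further leaf 0 attached to 1.  From v = 2a + 2 the
-- vertex 0 is at distance a + 2, the spine vertex 2k + 1 at distance ∣ a - k ∣ + 1 and
-- the leaf 2k + 2 ≠ v at distance ∣ a - k ∣ + 2: there are walks of these lengths, and
-- nothing shorter exists because the claimed distance varies by at most 1 along an edge.
-- The maximum is reached at 0 or at 2N + 2, so the eccentricity is max (a , N - a) + 2.
module Submission where

open import Defs
open import Data.Empty using (⊥-elim)
open import Data.Fin.Base using (Fin; toℕ; fromℕ<; zero)
open import Data.Fin.Properties using (toℕ<n; toℕ-fromℕ<; toℕ-injective)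
open import Data.Nat.Base
  using (ℕ; zero; suc; _+_; _*_; _∸_; _/_; _%_; _≤_; _<_; z≤n; s≤s; s≤s⁻¹; ∣_-_∣)
open import Data.Nat.Divisibility using (_∣_; divides)
open import Data.Nat.DivMod using (m*n/n≡m)
open import Data.Nat.Primality using (Prime)
open import Data.Nat.Properties
open import Data.Nat.Tactic.RingSolver using (solve-∀)
open import Data.Product.Base using (_×_; _,_; ∃-syntax)
open import Data.Sum.Base using (_⊎_; inj₁; inj₂)
open import Relation.Binary.Construct.Closure.Symmetric using (fwd; bwd)
open import Relation.Binary.PropositionalEquality
  using (_≡_; _≢_; refl; sym; trans; cong; subst; subst₂)
open import Relation.Nullary.Decidable.Core using (yes; no)
open import Relation.Nullary.Negation.Core using (¬_)

-- Walks and lower bounds for their lengths.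

module _ {G : SimpleGraph} where
  open SimpleGraph G

  infixr 5 _++_

  _++_ : ∀ {u v w d e} → Walk G u v d → Walk G v w e → Walk G u w (d + e)
  []      ++ q = q
  (x ∷ p) ++ q = x ∷ (p ++ q)

  reverse : ∀ {u v d} → Walk G u v d → Walk G v u d
  reverse []                        = []
  reverse {u} {v} {suc d} (x ∷ p) =
    subst (Walk G v u) (+-comm d 1) (reverse p ++ (adj-sym x ∷ []))

  walk-≤ : (f : Vertex → ℕ) → (∀ {u w} → Adj u w → f w ≤ suc (f u)) →
           ∀ {u w d} → Walk G u w d → f w ≤ f u + d
  walk-≤ f lip {u} []       = ≤-reflexive (sym (+-identityʳ (f u)))
  walk-≤ f lip {u} {w} {suc d} (x ∷ p) =
    ≤-trans (walk-≤ f lip p) (≤-trans (+-monoˡ-≤ d (lip x)) (≤-reflexive (sym (+-suc (f u) d))))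

  -- Since `f` starts at 0 and rises by at most 1 per step, every walk from `v` to `w` has length at
  -- least `f w`; a walk of that length is thus shortest.
  isDistance : ∀ {v} (f : Vertex → ℕ) → f v ≡ 0 → (∀ {u w} → Adj u w → f w ≤ suc (f u)) →
               ∀ {w} → Walk G v w (f w) → IsDistance G v w (f w)
  isDistance {v} f fv≡0 lip {w} p =
    p , λ e q → subst (λ z → f w ≤ z + e) fv≡0 (walk-≤ f lip q)

-- Coordinates on the vertices.

data Position : Set where
  origin     : Position
  spine leaf : ℕ → Position

label : Position → ℕ
label origin    = 0
label (spine k) = 1 + k * 2
label (leaf k)  = 2 + k * 2

2k+1≡label : ∀ k → 2 * k + 1 ≡ label (spine k)
2k+1≡label k = trans (+-comm (2 * k) 1) (cong suc (*-comm 2 k))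

2k+2≡label : ∀ k → 2 * k + 2 ≡ label (leaf k)
2k+2≡label k = trans (+-comm (2 * k) 2) (cong (2 +_) (*-comm 2 k))

2[1+k]∸1≡label : ∀ k → 2 * suc k ∸ 1 ≡ label (spine k)
2[1+k]∸1≡label k = cong (_∸ 1) (*-comm 2 (suc k))

shift : Position → Position
-- A default value: `positive-position` never yields `origin`.
shift origin    = origin
shift (spine k) = spine (suc k)
shift (leaf k)  = leaf (suc k)

-- The argument is the label minus 1. Adding 2 to a positive label keeps its kind and raises its
-- index, but from 0 it leads to `leaf 0`, so 0 stays outside the recursion.
positive-position : ℕ → Position
positive-position 0             = spine 0
positive-position 1             = leaf 0
positive-position (suc (suc m)) = shift (positive-position m)

position : ℕ → Position
position zero    = origin
position (suc m) = positive-position m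

positive-position-even : ∀ k → positive-position (k * 2) ≡ spine k
positive-position-even zero    = refl
positive-position-even (suc k) = cong shift (positive-position-even k)

positive-position-odd : ∀ k → positive-position (suc (k * 2)) ≡ leaf k
positive-position-odd zero    = refl
positive-position-odd (suc k) = cong shift (positive-position-odd k)

position-label : ∀ c → position (label c) ≡ c
position-label origin    = refl
position-label (spine k) = positive-position-even k
position-label (leaf k)  = positive-position-odd k

label-surjective : ∀ m → ∃[ c ] label c ≡ m
label-surjective 0 = origin , refl
label-surjective 1 = spine 0 , refl
label-surjective 2 = leaf 0 , refl
label-surjective (suc (suc (suc m))) with label-surjective (suc m)
... | spine k , eq = spine (suc k) , cong (2 +_) eq
... | leaf k  , eq = leaf (suc k) , cong (2 +_) eq

-- Candidate distances and estimates for them.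

leafDistance : ℕ → ℕ → ℕ
leafDistance a k with a ≟ k
-- Here the leaf is the starting vertex itself, where the general formula would give 2.
... | yes _ = 0
... | no  _ = 2 + ∣ a - k ∣

distance : ℕ → Position → ℕ
distance a origin    = 2 + a
distance a (spine k) = 1 + ∣ a - k ∣
distance a (leaf k)  = leafDistance a k

leafDistance-refl : ∀ a → leafDistance a a ≡ 0
leafDistance-refl a with a ≟ a
... | yes _  = refl
... | no a≢a = ⊥-elim (a≢a refl)

leafDistance-≢ : ∀ {a k} → a ≢ k → leafDistance a k ≡ 2 + ∣ a - k ∣
leafDistance-≢ {a} {k} a≢k with a ≟ k
... | yes a≡k = ⊥-elim (a≢k a≡k)
... | no _    = refl

leafDistance-≤ : ∀ a k → leafDistance a k ≤ 2 + ∣ a - k ∣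
leafDistance-≤ a k with a ≟ k
... | yes _ = z≤n
... | no _  = ≤-refl

-- This weak bound survives at `a ≡ k` and suffices for the edge between a leaf and its spine
-- vertex.
leafDistance-≥ : ∀ a k → ∣ a - k ∣ ≤ leafDistance a k
leafDistance-≥ a k with a ≟ k
... | yes a≡k = ≤-reflexive (m≡n⇒∣m-n∣≡0 a≡k)
... | no _    = m≤n+m _ 2

-- Each hypothesis handles one sign of `a - k`.
∣-∣-≤ : ∀ {a b k} → a ≤ k + b → k ≤ a + b → ∣ a - k ∣ ≤ b
∣-∣-≤ {a} {b} {k} a≤k+b k≤a+b with ≤-total a k
... | inj₁ a≤k = subst (_≤ b) (sym (m≤n⇒∣m-n∣≡n∸m a≤k)) (m≤n+o⇒m∸n≤o k a k≤a+b)
... | inj₂ k≤a = subst (_≤ b) (sym (m≤n⇒∣n-m∣≡n∸m k≤a)) (m≤n+o⇒m∸n≤o a k a≤k+b)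

∣-∣-suc-≤ : ∀ a k → ∣ a - suc k ∣ ≤ suc ∣ a - k ∣
∣-∣-suc-≤ zero    k       = ≤-refl
∣-∣-suc-≤ (suc a) zero    = ≤-trans (≤-reflexive (∣-∣-identityʳ a)) (m≤n+m a 2)
∣-∣-suc-≤ (suc a) (suc k) = ∣-∣-suc-≤ a k

∣-∣-≤-suc : ∀ a k → ∣ a - k ∣ ≤ suc ∣ a - suc k ∣
∣-∣-≤-suc zero    k       = m≤n+m k 2
∣-∣-≤-suc (suc a) zero    = ≤-reflexive (cong suc (sym (∣-∣-identityʳ a)))
∣-∣-≤-suc (suc a) (suc k) = ∣-∣-≤-suc a k

-- The caterpillar whose last index is `N`.

module _ (N : ℕ) where
  -- In this form `(order ∸ 3) / 2` computes to `N * 2 / 2`, so the edge bounds become `k ≤ N`.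
  order : ℕ
  order = 3 + N * 2

  private
    𝓕 : SimpleGraph
    𝓕 = foldedComponent order

    V : Set
    V = Fin order

  open SimpleGraph 𝓕 using (Adj; adj-sym)

  spine-bound : ∀ {w : V} k → toℕ w ≡ label (spine k) → k ≤ N
  spine-bound {w} k eq = s≤s⁻¹ (*-cancelʳ-< 2 k (suc N) (s≤s⁻¹ (subst (_< order) eq (toℕ<n w))))

  leaf-bound : ∀ {w : V} k → toℕ w ≡ label (leaf k) → k ≤ N
  leaf-bound {w} k eq =
    *-cancelʳ-≤ k N 2 (s≤s⁻¹ (s≤s⁻¹ (s≤s⁻¹ (subst (_< order) eq (toℕ<n w)))))

  spine<order : ∀ {k} → k ≤ N → label (spine k) < order
  spine<order k≤N = s≤s (≤-trans (s≤s (*-monoˡ-≤ 2 k≤N)) (n≤1+n _))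

  spineVertex : ∀ {k} → k ≤ N → V
  spineVertex k≤N = fromℕ< (spine<order k≤N)

  toℕ-spineVertex : ∀ {k} (k≤N : k ≤ N) → toℕ (spineVertex k≤N) ≡ label (spine k)
  toℕ-spineVertex k≤N = toℕ-fromℕ< (spine<order k≤N)

  leaf-edge : ∀ k {u w : V} → toℕ u ≡ label (spine k) → toℕ w ≡ label (leaf k) → Adj u w
  leaf-edge k u≡ w≡ = fwd (leaf k (subst (k ≤_) (sym (m*n/n≡m N 2)) (leaf-bound k w≡))
    (trans u≡ (sym (2k+1≡label k))) (trans w≡ (sym (2k+2≡label k))))

  spine-edge : ∀ k {u w : V} →
               toℕ u ≡ label (spine k) → toℕ w ≡ label (spine (suc k)) → Adj u w
  -- The constructor `path` is indexed by the upper end of the edge, hence `suc k`.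
  spine-edge k u≡ w≡ = fwd (path (suc k) (s≤s z≤n)
    (subst (suc k ≤_) (sym (m*n/n≡m N 2)) (spine-bound (suc k) w≡))
    (trans u≡ (sym (2[1+k]∸1≡label k))) (trans w≡ (sym (2k+1≡label (suc k)))))

  spine-walk-up : ∀ j {i} {u w : V} →
                  toℕ u ≡ label (spine i) → toℕ w ≡ label (spine (j + i)) → Walk 𝓕 u w j
  spine-walk-up zero u≡ w≡ with toℕ-injective (trans u≡ (sym w≡))
  ... | refl = []
  spine-walk-up (suc j) {i} {u} {w} u≡ w≡ =
    spine-edge i u≡ (toℕ-spineVertex 1+i≤N) ∷
    spine-walk-up j (toℕ-spineVertex 1+i≤N)
      (trans w≡ (cong (λ z → label (spine z)) (sym (+-suc j i))))
    where
    1+i≤N : suc i ≤ N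
    -- The next spine vertex exists because its index is at most that of the final vertex `w`.
    1+i≤N = ≤-trans (s≤s (m≤n+m i j)) (spine-bound (suc j + i) w≡)

  spine-walk : ∀ i k {u w : V} →
               toℕ u ≡ label (spine i) → toℕ w ≡ label (spine k) → Walk 𝓕 u w ∣ i - k ∣
  spine-walk i k u≡ w≡ with ≤-total i k
  ... | inj₁ i≤k = subst (Walk 𝓕 _ _) (sym (m≤n⇒∣m-n∣≡n∸m i≤k))
    (spine-walk-up (k ∸ i) u≡ (trans w≡ (cong (λ z → label (spine z)) (sym (m∸n+n≡m i≤k)))))
  ... | inj₂ k≤i = subst (Walk 𝓕 _ _) (sym (m≤n⇒∣n-m∣≡n∸m k≤i))
    (reverse (spine-walk-up (i ∸ k) w≡
      (trans u≡ (cong (λ z → label (spine z)) (sym (m∸n+n≡m k≤i))))))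

  -- Distances and eccentricity from the vertex `2a + 2`.

  module FromLeaf {a} {v : V} (v≡ : toℕ v ≡ label (leaf a)) where
    private
      a≤N : a ≤ N
      a≤N = leaf-bound a v≡

      hub : V
      hub = spineVertex a≤N

      hub≡ : toℕ hub ≡ label (spine a)
      hub≡ = toℕ-spineVertex a≤N

    -- The Lipschitz argument needs a function of the vertex alone, so the position is computed from
    -- the label; `at` evaluates it at a known position.
    vertexDistance : V → ℕ
    vertexDistance w = distance a (position (toℕ w))

    at : ∀ {w : V} c → toℕ w ≡ label c → vertexDistance w ≡ distance a c
    at c w≡ = cong (distance a) (trans (cong position w≡) (position-label c))

    to-spine : ∀ k {w : V} → toℕ w ≡ label (spine k) → Walk 𝓕 v w (1 + ∣ a - k ∣)
    to-spine k w≡ = adj-sym (leaf-edge a hub≡ v≡) ∷ spine-walk a k hub≡ w≡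

    walk-to : ∀ c {w : V} → toℕ w ≡ label c → Walk 𝓕 v w (distance a c)
    walk-to origin {w} w≡ =
      subst (Walk 𝓕 v w)
        (trans (+-comm _ 1) (cong (2 +_) (∣-∣-identityʳ a)))
        -- Vertex 0 is reached through vertex 1, along the root edge taken backwards.
        (to-spine 0 (toℕ-spineVertex z≤n) ++ (bwd (root w≡ (toℕ-spineVertex z≤n)) ∷ []))
    walk-to (spine k) w≡ = to-spine k w≡
    walk-to (leaf k) {w} w≡ with a ≟ k
    ... | yes refl with toℕ-injective (trans v≡ (sym w≡))
    ...   | refl = []
    walk-to (leaf k) {w} w≡ | no a≢k =
      subst (Walk 𝓕 v w) (+-comm _ 1)
        (to-spine k k≡ ++ (leaf-edge k k≡ w≡ ∷ []))
      where
      k≡ = toℕ-spineVertex (leaf-bound k w≡)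

    edge-lipschitz : ∀ {u w : V} → FoldedEdge order u w →
      vertexDistance w ≤ suc (vertexDistance u) × vertexDistance u ≤ suc (vertexDistance w)
    edge-lipschitz (path (suc k) _ _ u≡ w≡)
      rewrite at (spine k) (trans u≡ (2[1+k]∸1≡label k))
            | at (spine (suc k)) (trans w≡ (2k+1≡label (suc k))) =
      s≤s (∣-∣-suc-≤ a k) , s≤s (∣-∣-≤-suc a k)
    edge-lipschitz (leaf k _ u≡ w≡)
      rewrite at (spine k) (trans u≡ (2k+1≡label k)) | at (leaf k) (trans w≡ (2k+2≡label k)) =
      leafDistance-≤ a k , s≤s (leafDistance-≥ a k)
    edge-lipschitz (root u≡ w≡)
      rewrite at origin u≡ | at (spine 0) w≡ | ∣-∣-identityʳ a =
      m≤n+m (1 + a) 2 , ≤-refl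

    lipschitz : ∀ {u w : V} → Adj u w → vertexDistance w ≤ suc (vertexDistance u)
    lipschitz (fwd e) with edge-lipschitz e
    ... | le , _ = le
    lipschitz (bwd e) with edge-lipschitz e
    ... | _ , le = le

    isDistance-at : ∀ c {w : V} → toℕ w ≡ label c → IsDistance 𝓕 v w (distance a c)
    isDistance-at c {w} w≡ = subst (IsDistance 𝓕 v w) (at c w≡)
      (isDistance vertexDistance (trans (at (leaf a) v≡) (leafDistance-refl a)) lipschitz
        (subst (Walk 𝓕 v w) (sym (at c w≡)) (walk-to c w≡)))

    -- The hypotheses say that `b` is at least both `a` and `N - a`, the distances along the spine
    -- from index `a` to its two ends.
    distance-bounded : ∀ {b} → a ≤ b → N ≤ a + b →
                       ∀ c {w : V} → toℕ w ≡ label c → distance a c ≤ 2 + b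
    distance-bounded {b} a≤b N≤a+b = bound
      where
      gap : ∀ {k} → k ≤ N → ∣ a - k ∣ ≤ b
      gap {k} k≤N = ∣-∣-≤ (≤-trans a≤b (m≤n+m b k)) (≤-trans k≤N N≤a+b)
      bound : ∀ c {w : V} → toℕ w ≡ label c → distance a c ≤ 2 + b
      bound origin    _  = s≤s (s≤s a≤b)
      bound (spine k) w≡ = s≤s (≤-trans (gap (spine-bound k w≡)) (n≤1+n b))
      bound (leaf k)  w≡ = ≤-trans (leafDistance-≤ a k) (s≤s (s≤s (gap (leaf-bound k w≡))))

    -- The position `c` is the farthest one, chosen separately in each of the two cases below.
    isEccentricity : ∀ {b} → a ≤ b → N ≤ a + b →
                     ∀ c {w : V} → toℕ w ≡ label c → distance a c ≡ 2 + b →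
                     IsEccentricity 𝓕 v (2 + b)
    isEccentricity {b} a≤b N≤a+b c {w} w≡ c≡ = record
      { attained = w , subst (IsDistance 𝓕 v w) c≡ (isDistance-at c w≡)
      ; bounded  = bounded }
      where
      bounded : ∀ w → ∃[ d ] (IsDistance 𝓕 v w d × d ≤ 2 + b)
      bounded w with label-surjective (toℕ w)
      ... | c′ , eq = distance a c′ , isDistance-at c′ (sym eq)
                    , distance-bounded a≤b N≤a+b c′ (sym eq)

    eccentricity-far : N ≤ a + a → IsEccentricity 𝓕 v (2 + a)
    eccentricity-far N≤a+a = isEccentricity ≤-refl N≤a+a origin {zero} refl refl

    eccentricity-near : a + a < N → IsEccentricity 𝓕 v (2 + (N ∸ a))
    eccentricity-near a+a<N =
      isEccentricity (m+n≤o⇒m≤o∸n a (<⇒≤ a+a<N)) (≤-reflexive (sym (m+[n∸m]≡n a≤N)))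
        -- This is the last vertex: its label is `order` minus 1, so `≤-refl` shows that it exists.
        (leaf N) (toℕ-fromℕ< ≤-refl)
        -- From `a ≤ a + a < N` it follows that this leaf differs from `v`.
        (trans (leafDistance-≢ (<⇒≢ (≤-<-trans (m≤m+n a a) a+a<N)))
               (cong (2 +_) (m≤n⇒∣m-n∣≡n∸m a≤N)))

-- Arithmetic of the threshold and of the two values.

half-order : ∀ N → (order N + 1) / 2 ≡ 2 + N
half-order N = trans (cong (_/ 2) (double N)) (m*n/n≡m (2 + N) 2)
  where
  double : ∀ N → 3 + N * 2 + 1 ≡ (2 + N) * 2
  double = solve-∀

-- With `half-order`, cancelling 2 turns the comparison of `v` with the threshold into that of
-- `a + a` with `N`.
label-leaf : ∀ a → label (leaf a) ≡ 2 + (a + a)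
label-leaf a = cong (2 +_) (trans (*-comm a 2) (cong (a +_) (+-identityʳ a)))

far-value : ∀ a → label (leaf a) / 2 + 1 ≡ 2 + a
far-value a = trans (cong (_+ 1) (m*n/n≡m (suc a) 2)) (+-comm (suc a) 1)

near-value : ∀ {N a} → a ≤ N → (order N ∸ label (leaf a) + 3) / 2 ≡ 2 + (N ∸ a)
near-value {N} {a} a≤N =
  trans (cong (λ m → (m + 3) / 2)
          -- The difference of the labels is `1 + (N ∸ a) * 2`, and adding 3 makes it even.
          (trans (+-∸-assoc 1 (*-monoˡ-≤ 2 a≤N)) (cong suc (sym (*-distribʳ-∸ 2 N a)))))
  (trans (cong (_/ 2) (double (N ∸ a))) (m*n/n≡m (2 + (N ∸ a)) 2))
  where
  double : ∀ b → suc (b * 2) + 3 ≡ (2 + b) * 2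
  double = solve-∀

odd-order : ∀ {n} → ¬ (2 ∣ n) → 3 ≤ n → ∃[ N ] n ≡ order N
odd-order {n} odd 3≤n with label-surjective n
... | origin          , refl = ⊥-elim (odd (divides 0 refl))
-- This is `n = 1`; for `spine (suc N)` the label is `order N` by computation.
... | spine zero      , refl with s≤s () ← 3≤n
... | spine (suc N)   , refl = N , refl
... | leaf k          , refl = ⊥-elim (odd (divides (suc k) refl))

positive-even : ∀ {m} → m ≢ 0 → 2 ∣ m → ∃[ a ] m ≡ label (leaf a)
positive-even m≢0 (divides zero    eq) = ⊥-elim (m≢0 eq)
positive-even m≢0 (divides (suc a) eq) = a , eq

proposition27 : (p : ℕ) → Prime p → (p % 120 ≡ 71) ⊎ (p % 120 ≡ 119) →
    (𝔩 : Ideal (𝓞 p)) → IsPrimeAbove2 p 𝔩 →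
    (ord : ℕ) → IsClassOrder (𝓞 p) 𝔩 ord → ¬ (2 ∣ ord) → 3 ≤ ord →
    (v : Fin ord) → toℕ v ≢ 0 → 2 ∣ toℕ v →
    ((ord + 1) / 2 ≤ toℕ v →
    IsEccentricity (foldedComponent ord) v (toℕ v / 2 + 1))
    × (toℕ v < (ord + 1) / 2 →
    IsEccentricity (foldedComponent ord) v (((ord ∸ toℕ v) + 3) / 2))
proposition27 _ _ _ _ _ ord _ odd 3≤ord v v≢0 2∣v
  with odd-order odd 3≤ord | positive-even v≢0 2∣v
... | N , refl | a , v≡ rewrite v≡ = far , near
  where
  open FromLeaf N {a} v≡
  far : (order N + 1) / 2 ≤ label (leaf a) →
        IsEccentricity (foldedComponent (order N)) v (label (leaf a) / 2 + 1)
  far h = subst (IsEccentricity _ v) (sym (far-value a))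
    (eccentricity-far (s≤s⁻¹ (s≤s⁻¹ (subst₂ _≤_ (half-order N) (label-leaf a) h))))
  near : label (leaf a) < (order N + 1) / 2 →
         IsEccentricity (foldedComponent (order N)) v ((order N ∸ label (leaf a) + 3) / 2)
  near h = subst (IsEccentricity _ v) (sym (near-value (leaf-bound N a v≡)))
    (eccentricity-near (s≤s⁻¹ (s≤s⁻¹ (subst₂ _<_ (label-leaf a) (half-order N) h))))
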